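{- Let $m,n \in \mathbb{N}^*$ and $G \simeq C_m \oplus C_{mn}$. For every zero-sumfree sequence $S$ in $G$ with $|S| \geq m+mn-2$, one has $$\mathsf{k}(S) \leq \frac{m-1}{m}+\frac{mn-1}{mn}.$$ In particular, $\mathsf{k}(S) < 2$.
   Context: $C_k$ denotes the cyclic group of order $k$. A sequence in a finite abelian group $G$ (written additively) is a finite list $S=(g_1,\dots,g_\ell)$ of elements of $G$ (repetitions allowed), of length $|S|=\ell$. $S$ is zero-sumfree if $\sum_{i\in I} g_i \neq 0$ for every non-empty $I \subseteq \{1,\dots,\ell\}$. The cross number of $S$ is $\mathsf{k}(S)=\sum_{i=1}^{\ell} \frac{1}{\mathrm{ord}(g_i)}$. -}

module Defs where

open import Data.Nat using (ℕ; zero; suc; _+_; _*_; NonZero)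
open import Data.Nat.Properties using (m*n≢0)
open import Data.Nat.DivMod using (_mod_)
open import Data.Fin using (Fin; toℕ)
open import Data.Fin.Properties using () renaming (_≟_ to _≟F_)
open import Data.Fin.Subset using (Subset; Nonempty; inside; outside)
open import Data.Product using (_×_; _,_)
open import Data.Product.Properties using (≡-dec)
open import Data.Vec using (Vec; []; _∷_)
open import Data.Integer using (+_)
open import Data.Rational using (ℚ; 0ℚ; _/_) renaming (_+_ to _+ℚ_)
open import Relation.Nullary using (yes; no; Dec; ¬_)
open import Relation.Binary.PropositionalEquality using (_≡_)

module _ (m n : ℕ) .{{_ : NonZero m}} .{{_ : NonZero n}} where

  instance
    mn≢0 : NonZero (m * n)
    mn≢0 = m*n≢0 m n

  G : Set
  G = Fin m × Fin (m * n)

  _⊕_ : G → G → G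
  (a , b) ⊕ (c , d) = ((toℕ a + toℕ c) mod m) , ((toℕ b + toℕ d) mod (m * n))

  ε : G
  ε = (0 mod m) , (0 mod (m * n))

  _≟G_ : (g h : G) → Dec (g ≡ h)
  _≟G_ = ≡-dec _≟F_ _≟F_

  _·_ : ℕ → G → G
  zero · g = ε
  suc k · g = g ⊕ (k · g)

  -- ord g = least k ≥ 1 with k·g = 0.  The search runs over k = 1,…,mn,
  -- which suffices since (mn)·g = 0 for every g ∈ G.
  findFrom : ℕ → ℕ → G → ℕ
  findFrom zero j g = j
  findFrom (suc f) j g with (suc j · g) ≟G ε
  ... | yes _ = j
  ... | no _ = findFrom f (suc j) g

  ord : G → ℕ
  ord g = suc (findFrom (m * n) 0 g)

  subsum : ∀ {ℓ} → Vec G ℓ → Subset ℓ → G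
  subsum [] [] = ε
  subsum (g ∷ S) (inside ∷ I) = g ⊕ subsum S I
  subsum (g ∷ S) (outside ∷ I) = subsum S I

  ZeroSumFree : ∀ {ℓ} → Vec G ℓ → Set
  ZeroSumFree {ℓ} S = (I : Subset ℓ) → Nonempty I → ¬ (subsum S I ≡ ε)

  crossNumber : ∀ {ℓ} → Vec G ℓ → ℚ
  crossNumber [] = 0ℚ
  crossNumber (g ∷ S) = ((+ 1) / ord g) +ℚ crossNumber S

{-# OPTIONS --safe #-}
module Submission where

-- Let S be zero-sumfree of length at least m + mn − 2; this is D(G) − 1 for the Davenport constant
-- D(G) = m + mn − 1, which is obtained as Olson did: polynomial method for C_p ⊕ C_p, then induction on m.
-- From S one extracts many disjoint blocks whose sums lie in a subgroup H, using that short zero-sum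
-- sequences abound in G/H; an element of S already in H is a block of length one, so it saves terms.
-- With too many such elements there are D(H) blocks, hence a zero-sum subsequence of S.
-- Taking H = pG for a prime p | m, no element of S lies in pG.  Hence an element (x, y) of S has
-- order mn / gcd(y, n).
-- Taking H = {(x, y) : c | y} for 1 < c | n, fewer than m elements of S have c | y.
-- Finally mn k(S) = Σ gcd(y, n) = Σ_{k<n} #{(x, y) ∈ S : n | k y} ≤ |S| + (n − 1)(m − 1) = (m − 1)n + mn − 1.

open import Defs

module _ where

  open import Data.Bool using (Bool; true; false; if_then_else_)
  open import Data.Nat
    using (ℕ; zero; suc; _+_; _*_; _∸_; _≤_; _<_; z≤n; s≤s; NonZero; >-nonZero; >-nonZero⁻¹;
           ≢-nonZero; ≢-nonZero⁻¹; nonTrivial⇒n>1)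
  open import Data.Nat.Properties
  open import Data.Nat.Divisibility
  open import Data.Nat.DivMod
    using (_%_; _/_; _mod_; m%n<n; m%n%n≡m%n; m≡m%n+[m/n]*n; m/n*n≡m; %-distribˡ-+)
  open import Data.Nat.GCD
    using (gcd; gcd[m,n]∣m; gcd[m,n]∣n; gcd-greatest; c*gcd[m,n]≡gcd[cm,cn]; gcd[m,n]≡0⇒n≡0)
  open import Data.Nat.Induction using (Acc; acc; <-wellFounded)
  open import Data.Nat.ListAction using (sum)
  open import Data.Nat.ListAction.Properties using (sum-++; sum-↭)
  open import Data.Nat.Primality using (Prime; euclidsLemma; prime⇒nonTrivial)
  open import Data.Nat.Primality.Factorisation using (factorise)
  open import Data.Nat.Tactic.RingSolver using (solve-∀)
  open import Data.Integer as ℤ using (ℤ; 0ℤ; 1ℤ)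
  import Data.Integer.Divisibility.Signed as ℤ
  import Data.Integer.Properties as ℤ
  import Data.Integer.Tactic.RingSolver as ℤ-Solver
  open import Data.Rational as ℚ using (toℚᵘ)
  import Data.Rational.Properties as ℚ
  open import Data.Rational.Unnormalised as ℚᵘ using (mkℚᵘ; *≡*; *≤*; *<*)
  import Data.Rational.Unnormalised.Properties as ℚᵘ
  open import Data.Fin using (toℕ; zero; suc)
  open import Data.Fin.Properties using (pigeonhole; toℕ-fromℕ<; toℕ-injective; toℕ<n)
  open import Data.Fin.Subset using (Subset; Nonempty; inside; outside)
  open import Data.List using (List; []; _∷_; [_]; _++_; length; map; take; drop; concat)
  open import Data.List.Properties
    using (map-++; map-∘; map-id; take++drop≡id; ++-assoc; length-++; length-take; length-drop;
           concat-++; ∷-injectiveˡ; ∷-injectiveʳ)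
  open import Data.List.Membership.Propositional using (_∈_)
  open import Data.List.Membership.Propositional.Properties using (∈-∃++)
  open import Data.List.Relation.Unary.All as All using (All; []; _∷_)
  open import Data.List.Relation.Unary.All.Properties using (++⁻ˡ)
  open import Data.List.Relation.Unary.Any using (here; there)
  open import Data.List.Relation.Binary.Permutation.Propositional
    using (_↭_; prep; ↭-refl; ↭-reflexive; ↭-sym; ↭-trans)
  open import Data.List.Relation.Binary.Permutation.Propositional.Properties
    using (map⁺; ++⁺ˡ; ++⁺ʳ; ++-comm; shift; shifts; ↭-length; ↭-map-inv; All-resp-↭)
  open import Data.Product using (_×_; _,_; ∃; ∃₂; proj₁; proj₂)
  open import Data.Sum using (_⊎_; inj₁; inj₂; [_,_]′)
  open import Data.Vec using (Vec; []; _∷_; toList; here; there)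
  open import Data.Vec.Properties using (length-toList)
  open import Function using (_∘_; const)
  open import Relation.Nullary using (¬_; Dec; yes; no; contradiction)
  open import Relation.Nullary.Decidable using (decidable-stable)
  open import Relation.Binary.PropositionalEquality hiding ([_])

  private
    variable
      W : Set
      P Q : List W → Set
      ws us : List W

  -- Weights and subsequences

  wt : {W : Set} → (W → ℕ) → List W → ℕ
  wt f X = sum (map f X)

  -- Order is irrelevant to sums, so a subsequence is given up to permutation. The complement is
  -- kept because further blocks are extracted from it.
  record Sub {W : Set} (P : List W → Set) (ws : List W) : Set where
    constructor sub
    field
      chosen rest : List W
      split       : chosen ++ rest ↭ ws
      nonempty    : 0 < length chosen
      holds       : P chosen

  sub-map : (∀ {X} → P X → Q X) → Sub P ws → Sub Q ws
  sub-map h (sub X R s n p) = sub X R s n (h p)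

  sub-↭ : us ↭ ws → Sub P us → Sub P ws
  sub-↭ s (sub X R s′ ne h) = sub X R (↭-trans s′ s) ne h

  sub-trans : ∀ {X R : List W} → X ++ R ↭ ws → Sub P X → Sub P ws
  sub-trans {R = R} s (sub Y R′ s′ ne h) =
    sub Y (R′ ++ R) (↭-trans (↭-reflexive (sym (++-assoc Y R′ R))) (↭-trans (++⁺ʳ R s′) s)) ne h

  sub-take : ∀ k → Sub P (take k ws) → Sub P ws
  sub-take {ws = ws} k = sub-trans (↭-reflexive (take++drop≡id k ws))

  wt-++ : (f : W → ℕ) (X Y : List W) → wt f (X ++ Y) ≡ wt f X + wt f Y
  wt-++ f X Y = trans (cong sum (map-++ f X Y)) (sum-++ (map f X) (map f Y))

  wt-↭ : (f : W → ℕ) → ws ↭ us → wt f ws ≡ wt f us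
  wt-↭ f s = sum-↭ (map⁺ f s)

  -- The polynomial method

  Δ : W → (List W → ℤ) → List W → ℤ
  Δ v f X = f X ℤ.- f (v ∷ X)

  -- Functions on lists replace polynomials in 0-1 variables, and the degree is less than k when all
  -- k-fold differences vanish identically.
  Deg< : ℕ → (List W → ℤ) → Set
  Deg< zero    f = ∀ X → f X ≡ 0ℤ
  Deg< (suc k) f = ∀ v → Deg< k (Δ v f)

  deg-cong : ∀ k {f g : List W → ℤ} → (∀ X → f X ≡ g X) → Deg< k f → Deg< k g
  deg-cong zero    e d X = trans (sym (e X)) (d X)
  deg-cong (suc k) e d v = deg-cong k (λ X → cong₂ ℤ._-_ (e X) (e (v ∷ X))) (d v)

  deg-suc : ∀ k {f : List W → ℤ} → Deg< k f → Deg< (suc k) f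
  deg-suc zero    d v X = cong₂ ℤ._-_ (d X) (d (v ∷ X))
  deg-suc (suc k) d v   = deg-suc k (d v)

  deg-comb : ∀ k {f g : List W → ℤ} c → Deg< k f → Deg< k g → Deg< k (λ X → f X ℤ.- c ℤ.* g X)
  deg-comb zero    c d e X = trans (cong₂ (λ a b → a ℤ.- c ℤ.* b) (d X) (e X)) (ring c)
    where
    ring : ∀ c → 0ℤ ℤ.- c ℤ.* 0ℤ ≡ 0ℤ
    ring = ℤ-Solver.solve-∀
  deg-comb (suc k) {f} {g} c d e v =
    deg-cong k (λ X → ring c (f X) (f (v ∷ X)) (g X) (g (v ∷ X))) (deg-comb k {Δ v f} {Δ v g} c (d v) (e v))
    where
    ring : ∀ c a a′ b b′ → (a ℤ.- a′) ℤ.- c ℤ.* (b ℤ.- b′) ≡ (a ℤ.- c ℤ.* b) ℤ.- (a′ ℤ.- c ℤ.* b′)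
    ring = ℤ-Solver.solve-∀

  -- Follows from `f (v ∷ X)` = `f X` - `Δ v f X`.
  deg-∷ : ∀ k {f : List W → ℤ} v → Deg< k f → Deg< k (f ∘ (v ∷_))
  deg-∷ k {f} v d =
    deg-cong k (λ X → ring (f X) (f (v ∷ X))) (deg-comb k {f} {Δ v f} 1ℤ d (deg-suc k d v))
    where
    ring : ∀ a b → a ℤ.- 1ℤ ℤ.* (a ℤ.- b) ≡ b
    ring = ℤ-Solver.solve-∀

  -- Product rule: the difference of L f along v is L times the difference of f, minus c(v) times
  -- the shift of f.
  deg-affine : ∀ k {f L : List W → ℤ} {c : W → ℤ} → (∀ v X → L (v ∷ X) ≡ c v ℤ.+ L X) →
    Deg< k f → Deg< (suc k) (λ X → L X ℤ.* f X)
  deg-affine zero {f} {L} aff d v X =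
    cong₂ ℤ._-_ (trans (cong (L X ℤ.*_) (d X)) (ℤ.*-zeroʳ (L X)))
                (trans (cong (L (v ∷ X) ℤ.*_) (d (v ∷ X))) (ℤ.*-zeroʳ (L (v ∷ X))))
  deg-affine (suc k) {f} {L} {c} aff d v =
    deg-cong (suc k) step
      (deg-comb (suc k) {λ X → L X ℤ.* Δ v f X} {f ∘ (v ∷_)} (c v)
        (deg-affine k {Δ v f} {L} {c} aff (d v)) (deg-∷ (suc k) {f} v d))
    where
    ring : ∀ l c a b → l ℤ.* (a ℤ.- b) ℤ.- c ℤ.* b ≡ l ℤ.* a ℤ.- (c ℤ.+ l) ℤ.* b
    ring = ℤ-Solver.solve-∀
    step : ∀ X → L X ℤ.* Δ v f X ℤ.- c v ℤ.* f (v ∷ X) ≡ Δ v (λ Y → L Y ℤ.* f Y) X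
    step X = trans (ring (L X) (c v) (f X) (f (v ∷ X)))
                   (cong (λ l → L X ℤ.* f X ℤ.- l ℤ.* f (v ∷ X)) (sym (aff v X)))

  -- A function of degree < |vs| has vanishing iterated difference along vs, and g [] is one of its terms.
  nonvanishing-sub : ∀ (p : ℤ) (vs : List W) {g} → Deg< (length vs) g → ¬ p ℤ.∣ g [] →
    Sub (λ X → ¬ p ℤ.∣ g X) vs
  nonvanishing-sub p [] d n0 = contradiction (subst (p ℤ.∣_) (sym (d [])) (ℤ.divides 0ℤ refl)) n0
  nonvanishing-sub p (v ∷ vs) {g} d n0 with p ℤ.∣? Δ v g []
  ... | yes y = sub (v ∷ []) vs ↭-refl (s≤s z≤n)
                  (λ p∣gv → n0 (ℤ.∣m+n∣n⇒∣m y (ℤ.∣m⇒∣-m p∣gv)))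
  ... | no  n with nonvanishing-sub p vs (d v) n
  -- Here p does not divide `g X` - `g (v ∷ X)`, so it fails to divide one of the two.
  ...   | sub X R s ne h with p ℤ.∣? g X
  ...     | no  nX = sub X (v ∷ R) (↭-trans (shift v X R) (prep v s)) ne nX
  ...     | yes yX = sub (v ∷ X) R (prep v s) (s≤s z≤n) (λ yvX → h (ℤ.∣m∣n⇒∣m-n yX yvX))

  -- Modulo the prime q + 1, the factor (1 + wt L X) ⋯ (q + wt L X) vanishes unless q + 1 divides wt L X.
  rising : (W → ℕ) → ℕ → (List W → ℤ) → List W → ℤ
  rising L zero    f X = f X
  rising L (suc q) f X = ℤ.+ (suc q + wt L X) ℤ.* rising L q f X

  risings : List (W → ℕ) → ℕ → List W → ℤ
  risings []       q X = 1ℤ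
  risings (L ∷ Ls) q   = rising L q (risings Ls q)

  deg-rising : ∀ (L : W → ℕ) q {k f} → Deg< k f → Deg< (q + k) (rising L q f)
  deg-rising L zero d = d
  deg-rising L (suc q) {k} {f} d =
    deg-affine (q + k) {rising L q f} {λ X → ℤ.+ (suc q + wt L X)} {λ v → ℤ.+ L v} aff (deg-rising L q d)
    where
    aff : ∀ v X → ℤ.+ (suc q + (L v + wt L X)) ≡ ℤ.+ L v ℤ.+ ℤ.+ (suc q + wt L X)
    aff v X = cong ℤ.+_ (trans (sym (+-assoc (suc q) (L v) _))
      (trans (cong (_+ wt L X) (+-comm (suc q) (L v))) (+-assoc (L v) (suc q) _)))

  deg-risings : ∀ (Ls : List (W → ℕ)) q → Deg< (suc (length Ls * q)) (risings Ls q)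
  deg-risings []       q v X = refl
  deg-risings (L ∷ Ls) q = subst (λ k → Deg< k (risings (L ∷ Ls) q)) (+-suc q _)
                             (deg-rising L q (deg-risings Ls q))

  prime-∤-* : ∀ {p} → Prime p → ∀ a b → p ∤ ℤ.∣ a ∣ → ¬ ℤ.+ p ℤ.∣ b → ¬ ℤ.+ p ℤ.∣ a ℤ.* b
  prime-∤-* {p} pr a b na nb d =
    [ na , nb ∘ ℤ.∣ᵤ⇒∣ ]′ (euclidsLemma ℤ.∣ a ∣ ℤ.∣ b ∣ pr (subst (p ∣_) (ℤ.abs-* a b) (ℤ.∣⇒∣ᵤ d)))

  -- At the empty list the factors are 1, ..., q, all smaller than the prime p.
  rising-[]-∤ : ∀ {p} → Prime p → ∀ (L : W → ℕ) q {f} → q < p → ¬ ℤ.+ p ℤ.∣ f [] → ¬ ℤ.+ p ℤ.∣ rising L q f []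
  rising-[]-∤ pr L zero    q<p nf = nf
  rising-[]-∤ pr L (suc q) {f} q<p nf =
    prime-∤-* pr (ℤ.+ (suc q + 0)) (rising L q f []) (subst (λ x → _ ∤ suc x) (sym (+-identityʳ q)) (>⇒∤ q<p))
      (rising-[]-∤ pr L q {f} (<-trans (n<1+n q) q<p) nf)

  risings-[]-∤ : ∀ {p} → Prime p → ∀ (Ls : List (W → ℕ)) q → q < p → ¬ ℤ.+ p ℤ.∣ risings Ls q []
  risings-[]-∤ pr []       q q<p d = >⇒∤ (nonTrivial⇒n>1 _ {{prime⇒nonTrivial pr}}) (ℤ.∣⇒∣ᵤ d)
  risings-[]-∤ pr (L ∷ Ls) q q<p = rising-[]-∤ pr L q {risings Ls q} q<p (risings-[]-∤ pr Ls q q<p)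

  rising-∤⇒ : ∀ {p} (L : W → ℕ) q {f X} → ¬ ℤ.+ p ℤ.∣ rising L q f X →
    (∀ i → i < q → p ∤ suc i + wt L X) × (¬ ℤ.+ p ℤ.∣ f X)
  rising-∤⇒ L zero    n = (λ i ()) , n
  rising-∤⇒ {p = p} L (suc q) {f} {X} n with rising-∤⇒ L q {f} {X} (n ∘ ℤ.∣n⇒∣m*n (ℤ.+ (suc q + wt L X)))
  ... | small , nf = all , nf
    where
    all : ∀ i → i < suc q → p ∤ suc i + wt L X
    all i i<1+q d with m≤n⇒m<n∨m≡n (≤-pred i<1+q)
    ... | inj₁ i<q  = small i i<q d
    ... | inj₂ refl = n (ℤ.∣m⇒∣m*n {m = ℤ.+ (suc q + wt L X)} (rising L q f X) (ℤ.∣ᵤ⇒∣ d))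

  ∤-shifts⇒∣ : ∀ q x → (∀ i → i < q → suc q ∤ suc i + x) → suc q ∣ x
  ∤-shifts⇒∣ q x n = go (x % suc q) refl
    where
    go : ∀ r → x % suc q ≡ r → suc q ∣ x
    go zero    e = m%n≡0⇒n∣m x (suc q) e
    -- The nonzero residue `suc r` is completed to a multiple of q + 1 by adding q - r, which is one
    -- of the excluded shifts.
    go (suc r) e = contradiction (divides (suc (x / suc q)) eq) (n (q ∸ suc r) lt)
      where
      r<q : suc r ≤ q
      r<q = ≤-pred (subst (_< suc q) e (m%n<n x (suc q)))
      lt : q ∸ suc r < q
      lt = ∸-monoʳ-< {q} (s≤s z≤n) r<q
      eq : suc (q ∸ suc r) + x ≡ suc (x / suc q) * suc q
      eq = begin
        suc (q ∸ suc r) + x                                    ≡⟨ cong (suc (q ∸ suc r) +_) (m≡m%n+[m/n]*n x (suc q)) ⟩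
        suc (q ∸ suc r) + (x % suc q + x / suc q * suc q)      ≡⟨ cong (λ t → suc (q ∸ suc r) + (t + x / suc q * suc q)) e ⟩
        suc (q ∸ suc r) + (suc r + x / suc q * suc q)          ≡⟨ +-assoc (suc (q ∸ suc r)) (suc r) _ ⟨
        suc (q ∸ suc r) + suc r + x / suc q * suc q            ≡⟨ cong (λ t → suc t + x / suc q * suc q) (m∸n+n≡m r<q) ⟩
        suc q + x / suc q * suc q                              ∎
        where open ≡-Reasoning

  risings-∤⇒ : ∀ (Ls : List (W → ℕ)) q {X} → ¬ ℤ.+ suc q ℤ.∣ risings Ls q X → All (λ L → suc q ∣ wt L X) Ls
  risings-∤⇒ []       q n = []
  risings-∤⇒ (L ∷ Ls) q {X} n with rising-∤⇒ L q {risings Ls q} {X} n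
  ... | shifts , n′ = ∤-shifts⇒∣ q _ shifts ∷ risings-∤⇒ Ls q n′

  -- Olson's bound for C_p^r with p = q + 1. The product has r(p - 1) affine factors, is nonzero mod
  -- p at the empty list, and elsewhere is nonzero mod p only where all r coordinate sums vanish mod
  -- p.
  davenport-elementary : ∀ {q} → Prime (suc q) → (Ls : List (W → ℕ)) (ws : List W) →
    length ws ≡ suc (length Ls * q) → Sub (λ X → All (λ L → suc q ∣ wt L X) Ls) ws
  davenport-elementary {q = q} pr Ls ws e =
    sub-map (risings-∤⇒ Ls q)
      (nonvanishing-sub (ℤ.+ suc q) ws (subst (λ k → Deg< k (risings Ls q)) (sym e) (deg-risings Ls q))
        (risings-[]-∤ pr Ls q ≤-refl))

  -- Disjoint zero-sum blocks

  sub-[_] : ∀ w → P [ w ] → Sub P (w ∷ ws)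
  sub-[_] {ws = ws} w h = sub [ w ] ws ↭-refl (s≤s z≤n) h

  split-length : ∀ (X : List W) {R} → X ++ R ↭ ws → length X + length R ≡ length ws
  split-length X s = trans (sym (length-++ X)) (↭-length s)

  take-length : ∀ {k} (ws : List W) → k ≤ length ws → length (take k ws) ≡ k
  take-length {k = k} ws k≤ = trans (length-take k ws) (m≤n⇒m⊓n≡m k≤)

  wt-1 : (X : List W) → wt (const 1) X ≡ length X
  wt-1 []      = refl
  wt-1 (w ∷ X) = cong suc (wt-1 X)

  Divides : ℕ → (f g : W → ℕ) → List W → Set
  Divides p f g X = p ∣ wt f X × p ∣ wt g X

  module _ {q : ℕ} (pr : Prime (suc q)) (f g : W → ℕ) where

    elementary-rank2 : ∀ ws → suc (2 * q) ≤ length ws → Sub (Divides (suc q) f g) ws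
    elementary-rank2 ws h = sub-take (suc (2 * q))
      (sub-map (λ { (a ∷ b ∷ []) → a , b })
        (davenport-elementary pr (f ∷ g ∷ []) (take (suc (2 * q)) ws) (take-length ws h)))

    -- A zero-sum part Y of X minus one element is either short, or has a short complement in X.
    halve : ∀ X → length X ≡ 2 * suc q → Divides (suc q) f g X →
      Sub (λ Y → Divides (suc q) f g Y × length Y ≤ suc q) X
    -- Setting `w` aside leaves 2p - 1 elements, just enough for `elementary-rank2`, and makes the
    -- complement `w ∷ R` non-empty.
    halve (w ∷ X) e (pf , pg) with elementary-rank2 X (≤-reflexive (suc-injective (trans (ring q) (sym e))))
      where
      ring : ∀ q → suc (suc (2 * q)) ≡ 2 * suc q
      ring = solve-∀
    ... | sub Y R s ne (yf , yg) with length Y ≤? suc q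
    ...   | yes short = sub Y (w ∷ R) (↭-trans (shift w Y R) (prep w s)) ne ((yf , yg) , short)
    ...   | no  long  = sub (w ∷ R) Y (prep w (↭-trans (++-comm R Y) s)) (s≤s z≤n)
                          ((rest∣ f pf yf , rest∣ g pg yg) , +-cancelˡ-≤ (suc q) _ _ bound)
      where
      rest∣ : ∀ h → suc q ∣ wt h (w ∷ X) → suc q ∣ wt h Y → suc q ∣ wt h (w ∷ R)
      rest∣ h d dY = ∣m+n∣m⇒∣n (subst (suc q ∣_) eq d) dY
        where
        ring : ∀ a b c → a + (b + c) ≡ b + (a + c)
        ring = solve-∀
        eq : wt h (w ∷ X) ≡ wt h Y + wt h (w ∷ R)
        eq = trans (cong (h w +_) (trans (sym (wt-↭ h s)) (wt-++ h Y R))) (ring (h w) (wt h Y) (wt h R))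
      bound : suc q + suc (length R) ≤ suc q + suc q
      bound = begin
        suc q + suc (length R)    ≡⟨ +-suc (suc q) (length R) ⟩
        suc (suc q) + length R    ≤⟨ +-monoˡ-≤ (length R) (≰⇒> long) ⟩
        length Y + length R       ≡⟨ split-length Y s ⟩
        length X                  ≤⟨ n≤1+n _ ⟩
        suc (length X)            ≡⟨ e ⟩
        2 * suc q                 ≡⟨ cong (suc q +_) (+-identityʳ (suc q)) ⟩
        suc q + suc q             ∎
        where open ≤-Reasoning

    -- Adjoining the constant weight 1 forces the length of a zero-sum subsequence to be p or 2p.
    elementary-rank2-short : ∀ ws → suc (3 * q) ≤ length ws →
      Sub (λ X → Divides (suc q) f g X × length X ≤ suc q) ws
    elementary-rank2-short ws h = sub-take (suc (3 * q))
      (go (davenport-elementary pr (f ∷ g ∷ const 1 ∷ []) (take (suc (3 * q)) ws) (take-length ws h)))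
      where
      go : Sub (λ X → All (λ L → suc q ∣ wt L X) (f ∷ g ∷ const 1 ∷ [])) (take (suc (3 * q)) ws) →
        Sub (λ X → Divides (suc q) f g X × length X ≤ suc q) (take (suc (3 * q)) ws)
      go (sub X R s ne (pf ∷ pg ∷ p1 ∷ [])) with subst (suc q ∣_) (wt-1 X) p1
      ... | divides zero e = contradiction (subst (0 <_) e ne) (λ ())
      ... | divides (suc zero) e = sub X R s ne ((pf , pg) , ≤-reflexive (trans e (+-identityʳ _)))
      ... | divides (suc (suc zero)) e = sub-trans s (halve X e (pf , pg))
      -- Only 3p - 2 elements are available, so the length is below 3p.
      ... | divides (suc (suc (suc k))) e = contradiction bound (<-irrefl refl)
        where
        ring : ∀ q k → suc (suc (3 * q)) + suc (k * suc q) ≡ suc (suc (suc k)) * suc q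
        ring = solve-∀
        bound : suc (3 * q) < suc (3 * q)
        bound = begin
          suc (suc (3 * q))                       ≤⟨ m≤m+n _ _ ⟩
          suc (suc (3 * q)) + suc (k * suc q)     ≡⟨ ring q k ⟩
          suc (suc (suc k)) * suc q               ≡⟨ e ⟨
          length X                                ≤⟨ m≤m+n _ _ ⟩
          length X + length R                     ≡⟨ split-length X s ⟩
          length (take (suc (3 * q)) ws)          ≡⟨ take-length ws h ⟩
          suc (3 * q)                             ∎
          where open ≤-Reasoning

  record Blocks {W : Set} (P : List W → Set) (k : ℕ) (ws : List W) : Set where
    constructor blocks
    field
      parts : List (List W)
      rest  : List W
      split : concat parts ++ rest ↭ ws
      count : length parts ≡ k
      good  : All (λ B → 0 < length B × P B) parts

  blocks-[] : Blocks P 0 ws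
  blocks-[] {ws = ws} = blocks [] ws ↭-refl refl []

  blocks-∷ : ∀ {k} (S : Sub P ws) → Blocks P k (Sub.rest S) → Blocks P (suc k) ws
  blocks-∷ (sub X R s ne h) (blocks Bs R′ s′ e hs) =
    blocks (X ∷ Bs) R′
      (↭-trans (↭-reflexive (++-assoc X (concat Bs) R′)) (↭-trans (++⁺ˡ X s′) s))
      (cong suc e) ((ne , h) ∷ hs)

  -- The first j blocks use at most c elements each, which leaves s elements for a last block of
  -- unrestricted length.
  greedy-blocks : ∀ s c → (∀ ws → s ≤ length ws → Sub P ws) →
    (∀ ws → s + c ≤ length ws → Sub (λ X → P X × length X ≤ c) ws) →
    ∀ j ws → s + j * c ≤ length ws → Blocks P (suc j) ws
  greedy-blocks s c last step zero ws h =
    blocks-∷ (last ws (≤-trans (≤-reflexive (sym (+-identityʳ s))) h)) blocks-[]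
  greedy-blocks s c last step (suc j) ws h
    with step ws (≤-trans (+-monoʳ-≤ s (m≤m+n c (j * c))) h)
  ... | sub X R sp ne (p , short) =
    blocks-∷ (sub X R sp ne p) (greedy-blocks s c last step j R (+-cancelˡ-≤ c _ _ bound))
    where
    ring : ∀ s c d → c + (s + d) ≡ s + (c + d)
    ring = solve-∀
    bound : c + (s + j * c) ≤ c + length R
    bound = begin
      c + (s + j * c)       ≡⟨ ring s c (j * c) ⟩
      s + (c + j * c)       ≤⟨ h ⟩
      length ws             ≡⟨ split-length X sp ⟨
      length X + length R   ≤⟨ +-monoˡ-≤ (length R) short ⟩
      c + length R          ∎
      where open ≤-Reasoning

  concat⁺-↭ : ∀ {Bs Cs : List (List W)} → Bs ↭ Cs → concat Bs ↭ concat Cs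
  concat⁺-↭ _↭_.refl         = ↭-refl
  concat⁺-↭ (_↭_.prep B s)   = ++⁺ˡ B (concat⁺-↭ s)
  concat⁺-↭ (_↭_.swap B C s) = ↭-trans (shifts B C) (++⁺ˡ C (++⁺ˡ B (concat⁺-↭ s)))
  concat⁺-↭ (_↭_.trans s t)  = ↭-trans (concat⁺-↭ s) (concat⁺-↭ t)

  -- The inductive step of Olson's method: blocks become the terms of a new sequence, and a
  -- subfamily found there is concatenated to a subsequence of the old one.
  merge-blocks : ∀ {k} {Q : List (List W) → Set} {P′ : List W → Set} → (∀ Bs → All P Bs → Q Bs → P′ (concat Bs)) →
    (∀ Bs → length Bs ≡ k → Sub Q Bs) → Blocks P k ws → Sub P′ ws
  merge-blocks {P = P} merge zs (blocks Bs R s e hs) with zs Bs e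
  ... | sub Xs Rs s′ ne q = sub-trans s
    (sub (concat Xs) (concat Rs) (↭-trans (↭-reflexive (concat-++ Xs Rs)) (concat⁺-↭ s′))
      (concat-nonempty Xs ne hs′) (merge Xs (All.map proj₂ hs′) q))
    where
    hs′ : All (λ B → 0 < length B × P B) Xs
    hs′ = ++⁻ˡ Xs (All-resp-↭ (↭-sym s′) hs)
    concat-nonempty : ∀ Xs → 0 < length Xs → All (λ B → 0 < length B × P B) Xs → 0 < length (concat Xs)
    concat-nonempty (X ∷ Xs) _ ((ne , _) ∷ _) =
      ≤-trans ne (≤-trans (m≤m+n _ _) (≤-reflexive (sym (length-++ X))))

  wt-concat : (f : W → ℕ) (Bs : List (List W)) → wt (wt f) Bs ≡ wt f (concat Bs)
  wt-concat f []       = refl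
  wt-concat f (B ∷ Bs) = trans (cong (wt f B +_) (wt-concat f Bs)) (sym (wt-++ f B (concat Bs)))

  -- Dividing by p turns block sums in a subgroup of multiples of p into elements of a smaller
  -- group.
  wt-concat-/ : ∀ p .{{_ : NonZero p}} (f : W → ℕ) {Bs} → All (λ B → p ∣ wt f B) Bs →
    p * wt (λ B → wt f B / p) Bs ≡ wt f (concat Bs)
  wt-concat-/ p f [] = *-zeroʳ p
  wt-concat-/ p f {B ∷ Bs} (d ∷ ds) = begin
    p * (wt f B / p + wt (λ B → wt f B / p) Bs)       ≡⟨ *-distribˡ-+ p (wt f B / p) _ ⟩
    p * (wt f B / p) + p * wt (λ B → wt f B / p) Bs   ≡⟨ cong₂ _+_ (trans (*-comm p _) (m/n*n≡m d)) (wt-concat-/ p f ds) ⟩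
    wt f B + wt f (concat Bs)                         ≡⟨ wt-++ f B (concat Bs) ⟨
    wt f (B ++ concat Bs)                             ∎
    where open ≡-Reasoning

  ∣-wt-concat-/ : ∀ p .{{_ : NonZero p}} a (f : W → ℕ) {Bs} → All (λ B → p ∣ wt f B) Bs →
    a ∣ wt (λ B → wt f B / p) Bs → p * a ∣ wt f (concat Bs)
  ∣-wt-concat-/ p a f ds d = subst (p * a ∣_) (wt-concat-/ p f ds) (*-monoʳ-∣ p d)

  -- Davenport constants of cyclic groups and of C_m ⊕ C_mn

  %-≡⇒∣ : ∀ n .{{_ : NonZero n}} a x → a % n ≡ (a + x) % n → n ∣ x
  %-≡⇒∣ n a x e = ∣m+n∣m⇒∣n (divides ((a + x) / n) (+-cancelˡ-≡ (a % n) _ _ eq)) (n∣m*n (a / n))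
    where
    open ≡-Reasoning
    eq : a % n + (a / n * n + x) ≡ a % n + (a + x) / n * n
    eq = begin
      a % n + (a / n * n + x)           ≡⟨ +-assoc (a % n) _ x ⟨
      a % n + a / n * n + x             ≡⟨ cong (_+ x) (m≡m%n+[m/n]*n a n) ⟨
      a + x                             ≡⟨ m≡m%n+[m/n]*n (a + x) n ⟩
      (a + x) % n + (a + x) / n * n     ≡⟨ cong (_+ (a + x) / n * n) e ⟨
      a % n + (a + x) / n * n           ∎

  take-+ : ∀ i d (ws : List W) → take (i + d) ws ≡ take i ws ++ take d (drop i ws)
  take-+ zero    d ws       = refl
  take-+ (suc i) zero    [] = refl
  take-+ (suc i) (suc d) [] = refl
  take-+ (suc i) d (w ∷ ws) = cong (w ∷_) (take-+ i d ws)

  -- Two of the n + 1 prefix sums agree mod n, and the segment between them has sum zero. The length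
  -- bound makes the result fit for `greedy-blocks`.
  davenport-cyclic : ∀ n .{{_ : NonZero n}} (f : W → ℕ) ws → n ≤ length ws →
    Sub (λ X → n ∣ wt f X × length X ≤ n) ws
  davenport-cyclic n f ws h
    with i , j , i<j , e ← pigeonhole (n<1+n n) (λ i → wt f (take (toℕ i) ws) mod n)
    = sub X (take (toℕ i) ws ++ drop d (drop (toℕ i) ws)) split
        (subst (0 <_) (sym lenX) (m<n⇒0<n∸m i<j))
        (%-≡⇒∣ n (wt f (take (toℕ i) ws)) (wt f X) residues
        , subst (_≤ n) (sym lenX) (≤-trans (m∸n≤m _ (toℕ i)) j≤n))
    where
    d = toℕ j ∸ toℕ i
    X = take d (drop (toℕ i) ws)
    j≤n : toℕ j ≤ n
    j≤n = ≤-pred (toℕ<n j)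
    lenX : length X ≡ d
    lenX = take-length (drop (toℕ i) ws) (subst (d ≤_) (sym (length-drop (toℕ i) ws))
             (∸-monoˡ-≤ (toℕ i) (≤-trans j≤n h)))
    split : X ++ take (toℕ i) ws ++ drop d (drop (toℕ i) ws) ↭ ws
    split = ↭-trans (shifts X (take (toℕ i) ws))
              (↭-reflexive (trans (cong (take (toℕ i) ws ++_) (take++drop≡id d _)) (take++drop≡id (toℕ i) ws)))
    take-j : take (toℕ j) ws ≡ take (toℕ i) ws ++ X
    take-j = trans (cong (λ k → take k ws) (sym (m+[n∸m]≡n (<⇒≤ i<j)))) (take-+ (toℕ i) d ws)
    residues : wt f (take (toℕ i) ws) % n ≡ (wt f (take (toℕ i) ws) + wt f X) % n
    residues = trans (sym (toℕ-fromℕ< _)) (trans (cong toℕ e) (trans (toℕ-fromℕ< _)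
      (cong (_% n) (trans (cong (wt f) take-j) (wt-++ f (take (toℕ i) ws) X)))))

  -- Elements of C_m ⊕ C_mn enter through natural-number representatives of their coordinates, so
  -- that block sums can be divided.
  ZeroSum : (m n : ℕ) (f g : W → ℕ) → List W → Set
  ZeroSum m n f g X = m ∣ wt f X × m * n ∣ wt g X

  -- W varies so that a list of blocks is again a sequence to which the property applies.
  HasZeroSums : (m n : ℕ) → Set₁
  HasZeroSums m n = ∀ {W : Set} (f g : W → ℕ) ws → m + m * n ≤ suc (length ws) → Sub (ZeroSum m n f g) ws

  -- Let p = q + 1 and m = pa. Block sums in pG, divided by p, lie in C_a ⊕ C_an, where a + an - 1
  -- terms force a zero-sum.
  merge-divisible : ∀ q a n {k} → HasZeroSums a n → a + a * n ≤ suc k →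
    (f g : W → ℕ) → Blocks (Divides (suc q) f g) k ws → Sub (ZeroSum (suc q * a) n f g) ws
  merge-divisible q a n has h f g = merge-blocks merge
    (λ Bs e → has (λ B → wt f B / suc q) (λ B → wt g B / suc q) Bs (subst (λ l → a + a * n ≤ suc l) (sym e) h))
    where
    merge : ∀ Bs → All (Divides (suc q) f g) Bs → _ → ZeroSum (suc q * a) n f g (concat Bs)
    merge Bs ds (df , dg) =
      ∣-wt-concat-/ (suc q) a f (All.map proj₁ ds) df ,
      subst (_∣ wt g (concat Bs)) (sym (*-assoc (suc q) a n))
        (∣-wt-concat-/ (suc q) (a * n) g (All.map proj₂ ds) dg)

  -- A last block needs 2p - 1 elements. While another is to follow, 3p - 1 elements remain, and 3p
  -- - 2 already contain a block of length at most p.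
  divisible-blocks : ∀ {q} (pr : Prime (suc q)) (f g : W → ℕ) j ws →
    suc (2 * q) + j * suc q ≤ length ws → Blocks (Divides (suc q) f g) (suc j) ws
  divisible-blocks {q = q} pr f g = greedy-blocks (suc (2 * q)) (suc q)
    (elementary-rank2 pr f g)
    (λ ws h → elementary-rank2-short pr f g ws (≤-trans (≤-trans (n≤1+n _) (≤-reflexive (ring q))) h))
    where
    ring : ∀ q → suc (suc (3 * q)) ≡ suc (2 * q) + suc q
    ring = solve-∀

  prime-divisor : ∀ n .{{_ : NonZero n}} → n ≢ 1 → ∃ λ q → Prime (suc q) × suc q ∣ n
  prime-divisor n n≢1 with factorise n
  ... | record { factors = [] ; isFactorisation = e } = contradiction e n≢1
  ... | record { factors = suc q ∷ ps ; isFactorisation = e ; factorsPrime = pr ∷ _ } =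
    q , pr , subst (suc q ∣_) (sym e) (m∣m*n _)

  m+mn≡2+ : ∀ m n .{{_ : NonZero m}} .{{_ : NonZero n}} → m + m * n ≡ 2 + (m + m * n ∸ 2)
  m+mn≡2+ m n = sym (m+[n∸m]≡n (+-mono-≤ {1} {m} (>-nonZero⁻¹ m) (>-nonZero⁻¹ (m * n) {{m*n≢0 m n}})))

  -- Induction on m. For m = 1 the group is C_n; otherwise m = pa, and blocks with sums in pG reduce
  -- the claim to C_a ⊕ C_an.
  davenport-rank2 : ∀ m n .{{_ : NonZero m}} .{{_ : NonZero n}} → HasZeroSums m n
  davenport-rank2 m n = go m (<-wellFounded m)
    where
    go : ∀ m .{{_ : NonZero m}} → Acc _<_ m → HasZeroSums m n
    go m ac f g ws h with m ≟ 1
    go m ac f g ws h | yes refl =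
      sub-map (λ { (d , _) → 1∣ _ , subst (_∣ _) (sym (*-identityˡ n)) d })
        (davenport-cyclic n g ws (≤-trans (≤-reflexive (sym (*-identityˡ n))) (≤-pred h)))
    go m (acc rs) f g ws h | no m≢1 with prime-divisor m m≢1
    ... | q , pr , divides a refl =
      subst (λ k → Sub (ZeroSum k n f g) ws) (*-comm (suc q) a)
        (merge-divisible q a n (go a {{a≢0}} (rs a<m)) (≤-reflexive (m+mn≡2+ a n {{a≢0}})) f g
          (divisible-blocks pr f g j ws (≤-pred (≤-trans (≤-reflexive count) h))))
      where
      a≢0 : NonZero a
      a≢0 = m*n≢0⇒m≢0 a
      a<m : a < a * suc q
      a<m = m<m*n a (suc q) {{a≢0}} (nonTrivial⇒n>1 _ {{prime⇒nonTrivial pr}})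
      -- The number of blocks, j + 1, is the Davenport constant of C_a ⊕ C_an. Extracting them takes
      -- (2p - 1) + jp = m + mn - 1 elements, exactly the given bound.
      j = a + a * n ∸ 2
      ring₁ : ∀ q j → suc (suc (2 * q) + j * suc q) ≡ suc q * (2 + j)
      ring₁ = solve-∀
      ring₂ : ∀ q a n → suc q * (a + a * n) ≡ a * suc q + a * suc q * n
      ring₂ = solve-∀
      count : suc (suc (2 * q) + j * suc q) ≡ a * suc q + a * suc q * n
      count = trans (ring₁ q j) (trans (cong (suc q *_) (sym (m+mn≡2+ a n {{a≢0}}))) (ring₂ q a n))

  -- Zero-sums one term below the Davenport constant

  -- Since `w` lies in pG, it is a block by itself and costs one element instead of p. The p - 1 ≥ 1
  -- saved elements make up for the missing term.
  divisible-element : ∀ {p} → Prime p → ∀ a n .{{_ : NonZero a}} .{{_ : NonZero n}} (f g : W → ℕ) w ws →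
    p ∣ f w → p ∣ g w → p * a + p * a * n ≤ 3 + length ws → Sub (ZeroSum (p * a) n f g) (w ∷ ws)
  divisible-element {p = suc q} pr a n f g w ws df dg h =
    merge-divisible q a n (davenport-rank2 a n) (≤-reflexive (m+mn≡2+ a n)) f g
      (blocks-∷ (sub-[ w ] (subst (suc q ∣_) (sym (+-identityʳ (f w))) df ,
                            subst (suc q ∣_) (sym (+-identityʳ (g w))) dg))
        (remaining (a + a * n ∸ 2) refl))
    where
    q≥1 : 1 ≤ q
    q≥1 = ≤-pred (nonTrivial⇒n>1 _ {{prime⇒nonTrivial pr}})
    remaining : ∀ j → j ≡ a + a * n ∸ 2 → Blocks (Divides (suc q) f g) j ws
    -- This is the case a = n = 1, where `[ w ]` is the only block required.
    remaining zero    _ = blocks-[]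
    remaining (suc j) e = divisible-blocks pr f g j ws (+-cancelˡ-≤ 3 _ _ bound)
      where
      open ≤-Reasoning
      ring₁ : ∀ q j → q + 2 + (suc (2 * q) + j * suc q) ≡ suc q * (3 + j)
      ring₁ = solve-∀
      ring₂ : ∀ q a n → suc q * (a + a * n) ≡ suc q * a + suc q * a * n
      ring₂ = solve-∀
      bound : 3 + (suc (2 * q) + j * suc q) ≤ 3 + length ws
      bound = begin
        3 + (suc (2 * q) + j * suc q)          ≤⟨ +-monoˡ-≤ _ (+-monoˡ-≤ 2 q≥1) ⟩
        q + 2 + (suc (2 * q) + j * suc q)      ≡⟨ ring₁ q j ⟩
        suc q * (2 + suc j)                    ≡⟨ cong (λ k → suc q * (2 + k)) e ⟩
        suc q * (2 + (a + a * n ∸ 2))          ≡⟨ cong (suc q *_) (m+mn≡2+ a n) ⟨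
        suc q * (a + a * n)                    ≡⟨ ring₂ q a n ⟩
        suc q * a + suc q * a * n              ≤⟨ h ⟩
        3 + length ws                          ∎

  singleton-blocks : ∀ {k} {T : List W} → All (λ w → P [ w ]) T → Blocks P k us → Blocks P (length T + k) (T ++ us)
  singleton-blocks []       B = B
  singleton-blocks (h ∷ hs) B = blocks-∷ (sub-[ _ ] h) (singleton-blocks hs B)

  -- The subgroup H = {c | y} is C_m ⊕ C_me, with G/H cyclic of order c. The m singletons from `T`
  -- and me - 1 blocks from `U` reach its Davenport constant. The blocks from `U` take c(me - 1)
  -- elements, and `U` has at least cme - 2, enough because c ≥ 2.
  many-divisible : ∀ m c e .{{_ : NonZero m}} .{{_ : NonZero c}} .{{_ : NonZero e}} → 2 ≤ c → (f g : W → ℕ) (T U : List W) →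
    length T ≡ m → All (λ w → c ∣ g w) T → m + m * (c * e) ≤ 2 + length (T ++ U) →
    Sub (ZeroSum m (c * e) f g) (T ++ U)
  many-divisible m c e c≥2 f g T U lenT ds h =
    merge-blocks merge zs
      (singleton-blocks (All.map (λ {w} → subst (c ∣_) (sym (+-identityʳ (g w)))) ds)
        (remaining (m * e ∸ 1) refl))
    where
    merge : ∀ Bs → All (λ B → c ∣ wt g B) Bs → ZeroSum m e (wt f) (λ B → wt g B / c) Bs →
      ZeroSum m (c * e) f g (concat Bs)
    merge Bs ds (df , dg) = subst (m ∣_) (wt-concat f Bs) df ,
      subst (_∣ wt g (concat Bs)) (ring c m e) (∣-wt-concat-/ c (m * e) g ds dg)
      where
      ring : ∀ c m e → c * (m * e) ≡ m * (c * e)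
      ring = solve-∀
    me≡ : m * e ≡ suc (m * e ∸ 1)
    me≡ = sym (m+[n∸m]≡n (>-nonZero⁻¹ (m * e) {{m*n≢0 m e}}))
    zs : ∀ Bs → length Bs ≡ length T + (m * e ∸ 1) → Sub (ZeroSum m e (wt f) (λ B → wt g B / c)) Bs
    zs Bs eq = davenport-rank2 m e (wt f) (λ B → wt g B / c) Bs (≤-reflexive
      (trans (cong (m +_) me≡) (trans (+-suc m _) (cong suc (sym (trans eq (cong (_+ (m * e ∸ 1)) lenT)))))))
    remaining : ∀ i → i ≡ m * e ∸ 1 → Blocks (λ B → c ∣ wt g B) i U
    remaining zero    _  = blocks-[]
    -- In C_c the same number c suffices for finding a block and bounds its length.
    remaining (suc j) eq = greedy-blocks c c (λ ws → sub-map proj₁ ∘ davenport-cyclic c g ws)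
      (λ ws → davenport-cyclic c g ws ∘ ≤-trans (m≤m+n c c)) j U (+-cancelˡ-≤ (m + 2) _ _ bound)
      where
      open ≤-Reasoning
      ring₁ : ∀ m c j → m + c + (c + j * c) ≡ m + c * (2 + j)
      ring₁ = solve-∀
      ring₂ : ∀ m c e → m + c * (m * e) ≡ m + m * (c * e)
      ring₂ = solve-∀
      ring₃ : ∀ m u → 2 + (m + u) ≡ m + 2 + u
      ring₃ = solve-∀
      bound : m + 2 + (c + j * c) ≤ m + 2 + length U
      bound = begin
        m + 2 + (c + j * c)          ≤⟨ +-monoˡ-≤ _ (+-monoʳ-≤ m c≥2) ⟩
        m + c + (c + j * c)          ≡⟨ ring₁ m c j ⟩
        m + c * suc (suc j)          ≡⟨ cong (λ k → m + c * suc k) eq ⟩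
        m + c * suc (m * e ∸ 1)      ≡⟨ cong (λ k → m + c * k) me≡ ⟨
        m + c * (m * e)              ≡⟨ ring₂ m c e ⟩
        m + m * (c * e)              ≤⟨ h ⟩
        2 + length (T ++ U)          ≡⟨ cong (2 +_) (trans (length-++ T) (cong (_+ length U) lenT)) ⟩
        2 + (m + length U)           ≡⟨ ring₃ m (length U) ⟩
        m + 2 + length U             ∎

  -- Long zero-sumfree sequences

  indicator : {A : Set} → Dec A → ℕ
  indicator (yes _) = 1
  indicator (no  _) = 0

  select : {P : W → Set} (P? : ∀ w → Dec (P w)) → ∀ k ws → k ≤ wt (indicator ∘ P?) ws →
    ∃₂ λ T U → length T ≡ k × All P T × T ++ U ↭ ws
  select P? zero ws h = [] , ws , refl , [] , ↭-refl
  select P? (suc k) (w ∷ ws) h with P? w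
  ... | yes Pw with select P? k ws (≤-pred h)
  ...   | T , U , e , Ps , s = w ∷ T , U , cong suc e , Pw ∷ Ps , prep w s
  select P? (suc k) (w ∷ ws) h | no _ with select P? (suc k) ws h
  ...   | T , U , e , Ps , s = T , w ∷ U , e , Ps , ↭-trans (shift w T U) (prep w s)

  wt-≤-length : ∀ (f : W → ℕ) → (∀ w → f w ≤ 1) → ∀ ws → wt f ws ≤ length ws
  wt-≤-length f f≤1 []       = z≤n
  wt-≤-length f f≤1 (w ∷ ws) = +-mono-≤ (f≤1 w) (wt-≤-length f f≤1 ws)

  indicator≤1 : {A : Set} (A? : Dec A) → indicator A? ≤ 1
  indicator≤1 (yes _) = ≤-refl
  indicator≤1 (no  _) = z≤n

  wt-+ : ∀ (f g : W → ℕ) ws → wt (λ w → f w + g w) ws ≡ wt f ws + wt g ws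
  wt-+ f g []       = refl
  wt-+ f g (w ∷ ws) = trans (cong (f w + g w +_) (wt-+ f g ws)) (ring (f w) (g w) (wt f ws) (wt g ws))
    where
    ring : ∀ a b c d → a + b + (c + d) ≡ a + c + (b + d)
    ring = solve-∀

  -- #{k < K : n ∣ k y}; for K = n this is gcd y n.
  annihilators : (n y K : ℕ) → ℕ
  annihilators n y zero    = 0
  annihilators n y (suc K) = indicator (n ∣? K * y) + annihilators n y K

  annihilators-mono : ∀ n y d K → annihilators n y K ≤ annihilators n y (d + K)
  annihilators-mono n y zero    K = ≤-refl
  annihilators-mono n y (suc d) K = ≤-trans (annihilators-mono n y d K) (m≤n+m _ _)

  -- The multiples 0, c + 1, ..., (j - 1)(c + 1) are all counted.
  annihilators-≥ : ∀ n y c → n ∣ suc c * y → ∀ j → j ≤ annihilators n y (j * suc c)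
  annihilators-≥ n y c d zero    = z≤n
  annihilators-≥ n y c d (suc j) = begin
    suc j                                          ≤⟨ s≤s (annihilators-≥ n y c d j) ⟩
    suc (annihilators n y (j * suc c))             ≡⟨ cong (_+ annihilators n y (j * suc c)) hit ⟨
    annihilators n y (suc (j * suc c))             ≤⟨ annihilators-mono n y c (suc (j * suc c)) ⟩
    annihilators n y (c + suc (j * suc c))         ≡⟨ cong (annihilators n y) (+-suc c (j * suc c)) ⟩
    annihilators n y (suc j * suc c)               ∎
    where
    open ≤-Reasoning
    hit : indicator (n ∣? j * suc c * y) ≡ 1
    hit with n ∣? j * suc c * y
    ... | yes _ = refl
    ... | no ¬d = contradiction (subst (n ∣_) (sym (*-assoc j (suc c) y)) (∣n⇒∣m*n j d)) ¬d

  -- With g = gcd(y, n), the number n / g sends y to a multiple of n, and it has g multiples below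
  -- n, counting 0.
  gcd≤annihilators : ∀ n .{{_ : NonZero n}} y → gcd y n ≤ annihilators n y n
  gcd≤annihilators n y with gcd[m,n]∣m y n | gcd[m,n]∣n y n
  ... | _ | divides zero e = contradiction e (≢-nonZero⁻¹ n)
  ... | divides x ex | divides (suc c) e =
    subst (λ k → gcd y n ≤ annihilators n y k) (trans (*-comm (gcd y n) (suc c)) (sym e))
      (annihilators-≥ n y c (divides x eq) (gcd y n))
    where
    ring : ∀ a x g → a * (x * g) ≡ x * (a * g)
    ring = solve-∀
    eq : suc c * y ≡ x * n
    eq = trans (cong (suc c *_) ex) (trans (ring (suc c) x (gcd y n)) (cong (x *_) (sym e)))

  ∣-*-gcd : ∀ d c m n → d ∣ c * m → d ∣ c * n → d ∣ c * gcd m n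
  ∣-*-gcd d c m n dm dn = subst (d ∣_) (sym (c*gcd[m,n]≡gcd[cm,cn] c m n)) (gcd-greatest dm dn)

  module _ (m n : ℕ) .{{_ : NonZero m}} .{{_ : NonZero n}} (f g : W → ℕ) (ws : List W)
           (zsf : ¬ Sub (ZeroSum m n f g) ws) where

    zerosumfree-length : 2 + length ws ≤ m + m * n
    zerosumfree-length = ≰⇒> (zsf ∘ davenport-rank2 m n f g ws)

    module _ (long : m + m * n ≤ 2 + length ws) where

      -- A prime factor p of d would divide m and put `w` in pG, so `divisible-element` would yield
      -- a zero-sum subsequence.
      common-divisor≡1 : ∀ {w} → w ∈ ws → ∀ d → d ∣ m → d ∣ f w → d ∣ g w → d ≡ 1
      common-divisor≡1 {w} w∈ws d d∣m d∣f d∣g = decidable-stable (d ≟ 1) ¬d≢1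
        where
        instance
          d≢0 : NonZero d
          d≢0 = ≢-nonZero (λ { refl → ≢-nonZero⁻¹ m (0∣⇒≡0 d∣m) })
        ¬d≢1 : ¬ (d ≢ 1)
        ¬d≢1 d≢1 with prime-divisor d d≢1 | ∈-∃++ w∈ws
        ... | q , pr , p∣d | ys , zs , refl with ∣-trans p∣d d∣m
        ...   | divides a m≡ = zsf (sub-↭ (↭-sym (shift w ys zs)) (subst (λ k → Sub (ZeroSum k n f g) (w ∷ ys ++ zs)) (sym m≡pa)
                  (divisible-element pr a n f g w (ys ++ zs) (∣-trans p∣d d∣f) (∣-trans p∣d d∣g)
                    (subst₂ (λ k l → k + k * n ≤ 2 + l) m≡pa (↭-length (shift w ys zs)) long))))
          where
          m≡pa : m ≡ suc q * a
          m≡pa = trans m≡ (*-comm a (suc q))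
          instance
            a≢0 : NonZero a
            a≢0 = ≢-nonZero (λ { refl → ≢-nonZero⁻¹ m m≡ })

      -- As m divides o x, o y and o m, and gcd(x, y, m) = 1, it divides o. Hence mn divides both o
      -- y and o n, and so o gcd(y, n).
      order-bound : ∀ {w} → w ∈ ws → ∀ o → 0 < o → m ∣ o * f w → m * n ∣ o * g w →
        m * n ≤ o * annihilators n (g w) n
      order-bound {w} w∈ws o 0<o df dg = begin
        m * n                            ≤⟨ ∣⇒≤ {{o*gcd≢0}} (∣-*-gcd (m * n) o (g w) n dg (*-monoˡ-∣ n m∣o)) ⟩
        o * gcd (g w) n                  ≤⟨ *-monoʳ-≤ o (gcd≤annihilators n (g w)) ⟩
        o * annihilators n (g w) n       ∎
        where
        open ≤-Reasoning
        o*gcd≢0 : NonZero (o * gcd (g w) n)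
        o*gcd≢0 = m*n≢0 o _ {{>-nonZero 0<o}}
          {{≢-nonZero (≢-nonZero⁻¹ n ∘ gcd[m,n]≡0⇒n≡0 (g w))}}
        D = gcd (gcd (f w) (g w)) m
        D∣fg : D ∣ gcd (f w) (g w)
        D∣fg = gcd[m,n]∣m (gcd (f w) (g w)) m
        D≡1 : D ≡ 1
        D≡1 = common-divisor≡1 w∈ws D (gcd[m,n]∣n (gcd (f w) (g w)) m)
          (∣-trans D∣fg (gcd[m,n]∣m (f w) (g w))) (∣-trans D∣fg (gcd[m,n]∣n (f w) (g w)))
        m∣o : m ∣ o
        m∣o = subst (m ∣_) (trans (cong (o *_) D≡1) (*-identityʳ o))
          (∣-*-gcd m o (gcd (f w) (g w)) m (∣-*-gcd m o (f w) (g w) df (∣-trans (m∣m*n n) dg)) (n∣m*n o))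

      few-divisible : ∀ c e → n ≡ c * e → 2 ≤ c → wt (λ w → indicator (c ∣? g w)) ws < m
      few-divisible c e refl c≥2 = ≰⇒> λ m≤ → too-many (select (λ w → c ∣? g w) m ws m≤)
        where
        instance
          c≢0 : NonZero c
          c≢0 = m*n≢0⇒m≢0 c
          e≢0 : NonZero e
          e≢0 = m*n≢0⇒n≢0 c
        too-many : ¬ (∃₂ λ T U → length T ≡ m × All (λ w → c ∣ g w) T × T ++ U ↭ ws)
        too-many (T , U , lenT , ds , s) = zsf (sub-↭ s (many-divisible m c e c≥2 f g T U lenT ds
          (subst (λ l → m + m * (c * e) ≤ 2 + l) (sym (↭-length s)) long)))

      -- If n divides K y, then c = n / gcd(K, n) divides y. Since 0 < K < n, c is at least 2 and
      -- `few-divisible` applies.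
      few-annihilated : ∀ K → 0 < K → K < n → wt (λ w → indicator (n ∣? K * g w)) ws ≤ m ∸ 1
      few-annihilated K 0<K K<n with gcd[m,n]∣n K n
      ... | divides c e = ≤-trans (indicator-mono ws) (∸-monoˡ-≤ 1 (few-divisible c D e c≥2))
        where
        D = gcd K n
        instance
          D≢0 : NonZero D
          D≢0 = ≢-nonZero (≢-nonZero⁻¹ n ∘ gcd[m,n]≡0⇒n≡0 K)
        D<n : D < n
        D<n = ≤-<-trans (∣⇒≤ {{>-nonZero 0<K}} (gcd[m,n]∣m K n)) K<n
        c≥2 : 2 ≤ c
        c≥2 = *-cancelʳ-< D 1 c (subst₂ _<_ (sym (*-identityˡ D)) e D<n)
        c∣ : ∀ y → n ∣ K * y → c ∣ y
        c∣ y d = *-cancelʳ-∣ D (subst₂ _∣_ e refl (∣-*-gcd n y K n (subst (n ∣_) (*-comm K y) d) (n∣m*n y)))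
        indicator-mono : ∀ us → wt (λ w → indicator (n ∣? K * g w)) us ≤ wt (λ w → indicator (c ∣? g w)) us
        indicator-mono []       = z≤n
        indicator-mono (w ∷ us) = +-mono-≤ at-w (indicator-mono us)
          where
          at-w : indicator (n ∣? K * g w) ≤ indicator (c ∣? g w)
          at-w with n ∣? K * g w | c ∣? g w
          ... | yes _ | yes _ = ≤-refl
          ... | yes d | no ¬d = contradiction (c∣ (g w) d) ¬d
          ... | no  _ | _     = z≤n

      -- Double counting: the multiplier 0 contributes at most |S|, and each further multiplier at
      -- most m - 1.
      total-annihilators-≤ : ∀ k → suc k ≤ n →
        wt (λ w → annihilators n (g w) (suc k)) ws ≤ length ws + k * (m ∸ 1)
      total-annihilators-≤ zero    h = ≤-trans (wt-≤-length _ at-most-1 ws) (m≤m+n _ _)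
        where
        at-most-1 : ∀ w → annihilators n (g w) 1 ≤ 1
        at-most-1 w = ≤-trans (≤-reflexive (+-identityʳ _)) (indicator≤1 (n ∣? 0))
      total-annihilators-≤ (suc k) h = begin
        wt (λ w → annihilators n (g w) (suc (suc k))) ws
          ≡⟨ wt-+ (λ w → indicator (n ∣? suc k * g w)) (λ w → annihilators n (g w) (suc k)) ws ⟩
        wt (λ w → indicator (n ∣? suc k * g w)) ws + wt (λ w → annihilators n (g w) (suc k)) ws
          ≤⟨ +-mono-≤ (few-annihilated (suc k) (s≤s z≤n) h) (total-annihilators-≤ k (<⇒≤ h)) ⟩
        (m ∸ 1) + (length ws + k * (m ∸ 1))
          ≡⟨ ring (m ∸ 1) (length ws) k ⟩
        length ws + suc k * (m ∸ 1) ∎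
        where
        open ≤-Reasoning
        ring : ∀ a l k → a + (l + k * a) ≡ l + suc k * a
        ring = solve-∀

      -- Combines |S| ≤ m + mn - 2 with (m + mn - 2) + (n - 1)(m - 1) = (m - 1)n + mn - 1.
      total-annihilators : wt (λ w → annihilators n (g w) n) ws ≤ (m ∸ 1) * n + (m * n ∸ 1)
      total-annihilators = arith m n (λ k → wt (λ w → annihilators n (g w) k) ws) total-annihilators-≤ zerosumfree-length
        where
        arith : ∀ m n .{{_ : NonZero m}} .{{_ : NonZero n}} {l} (a : ℕ → ℕ) → (∀ k → suc k ≤ n → a (suc k) ≤ l + k * (m ∸ 1)) →
          2 + l ≤ m + m * n → a n ≤ (m ∸ 1) * n + (m * n ∸ 1)
        arith (suc m) (suc n) {l} a bound len = begin
          a (suc n)                             ≤⟨ bound n ≤-refl ⟩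
          l + n * m                             ≤⟨ +-monoˡ-≤ (n * m) (≤-pred (≤-trans (≤-pred len) (≤-reflexive (+-suc m _)))) ⟩
          m + (n + m * suc n) + n * m           ≡⟨ ring m n ⟩
          m * suc n + (n + m * suc n)           ∎
          where
          open ≤-Reasoning
          ring : ∀ m n → m + (n + m * suc n) + n * m ≡ m * suc n + (n + m * suc n)
          ring = solve-∀

  -- Transfer to Vec and ℚ

  toℕ-mod : ∀ a k .{{_ : NonZero k}} → toℕ (a mod k) ≡ a % k
  toℕ-mod a k = toℕ-fromℕ< (m%n<n a k)

  mod-cong : ∀ {a b} k .{{_ : NonZero k}} → a % k ≡ b % k → a mod k ≡ b mod k
  mod-cong {a} {b} k e = toℕ-injective (trans (toℕ-mod a k) (trans e (sym (toℕ-mod b k))))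

  +-mod : ∀ a b k .{{_ : NonZero k}} → (a + toℕ (b mod k)) mod k ≡ (a + b) mod k
  +-mod a b k = mod-cong k (begin
    (a + toℕ (b mod k)) % k        ≡⟨ cong (λ t → (a + t) % k) (toℕ-mod b k) ⟩
    (a + b % k) % k                ≡⟨ %-distribˡ-+ a (b % k) k ⟩
    (a % k + b % k % k) % k        ≡⟨ cong (λ t → (a % k + t) % k) (m%n%n≡m%n b k) ⟩
    (a % k + b % k) % k            ≡⟨ %-distribˡ-+ a b k ⟨
    (a + b) % k                    ∎)
    where open ≡-Reasoning

  mod≡0⇒∣ : ∀ a k .{{_ : NonZero k}} → a mod k ≡ 0 mod k → k ∣ a
  mod≡0⇒∣ a k e = %-≡⇒∣ k 0 a (trans (sym (toℕ-mod 0 k)) (trans (cong toℕ (sym e)) (toℕ-mod a k)))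

  ∣⇒mod≡0 : ∀ a k .{{_ : NonZero k}} → k ∣ a → a mod k ≡ 0 mod k
  ∣⇒mod≡0 a k d = mod-cong k (trans (n∣m⇒m%n≡0 a k d) (sym (n∣m⇒m%n≡0 0 k (k ∣0))))

  -- Boolean labels let a choice of terms travel along a permutation back to the original order,
  -- where it becomes a `Subset` of positions.
  selected : (W → ℕ) → Bool × W → ℕ
  selected f (b , w) = if b then f w else 0

  wt-selected : ∀ (f : W → ℕ) X R →
    wt (selected f) (map (true ,_) X ++ map (false ,_) R) ≡ wt f X
  wt-selected f (w ∷ X) R       = cong (f w +_) (wt-selected f X R)
  wt-selected f []      []      = refl
  wt-selected f []      (_ ∷ R) = wt-selected f [] R

  module _ (m n : ℕ) .{{_ : NonZero m}} .{{_ : NonZero n}} where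

    private
      instance
        mn-nonZero : NonZero (m * n)
        mn-nonZero = m*n≢0 m n

    Elt : Set
    Elt = G m n

    x-coord y-coord : Elt → ℕ
    x-coord g = toℕ (proj₁ g)
    y-coord g = toℕ (proj₂ g)

    residue : ℕ → ℕ → Elt
    residue a b = a mod m , b mod (m * n)

    ⊕-residue : ∀ g a b → _⊕_ m n g (residue a b) ≡ residue (x-coord g + a) (y-coord g + b)
    ⊕-residue g a b = cong₂ _,_ (+-mod (x-coord g) a m) (+-mod (y-coord g) b (m * n))

    ·-residue : ∀ k g → _·_ m n k g ≡ residue (k * x-coord g) (k * y-coord g)
    ·-residue zero    g = refl
    ·-residue (suc k) g = trans (cong (_⊕_ m n g) (·-residue k g)) (⊕-residue g (k * x-coord g) (k * y-coord g))

    findFrom-spec : ∀ fuel j g → _·_ m n (suc (findFrom m n fuel j g)) g ≡ ε m n ⊎ findFrom m n fuel j g ≡ j + fuel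
    findFrom-spec zero       j g = inj₂ (sym (+-identityʳ j))
    findFrom-spec (suc fuel) j g with _≟G_ m n (_·_ m n (suc j) g) (ε m n)
    ... | yes e = inj₁ e
    ... | no _ with findFrom-spec fuel (suc j) g
    ...   | inj₁ e = inj₁ e
    ...   | inj₂ e = inj₂ (trans e (sym (+-suc j fuel)))

    -- The second alternative is an unsuccessful search; it never occurs but is harmless.
    ord-spec : ∀ g → (m ∣ ord m n g * x-coord g × m * n ∣ ord m n g * y-coord g) ⊎ m * n ≤ ord m n g
    ord-spec g with findFrom-spec (m * n) 0 g
    ... | inj₁ e = let e′ = trans (sym (·-residue (ord m n g) g)) e in
      inj₁ (mod≡0⇒∣ _ m (cong proj₁ e′) , mod≡0⇒∣ _ (m * n) (cong proj₂ e′))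
    ... | inj₂ e = inj₂ (≤-trans (≤-reflexive (sym e)) (n≤1+n _))

    subset-of : ∀ {ℓ} (S : Vec Elt ℓ) (ls : List (Bool × Elt)) → map proj₂ ls ≡ toList S →
      ∃ λ (I : Subset ℓ) →
        subsum m n S I ≡ residue (wt (selected x-coord) ls) (wt (selected y-coord) ls) ×
        (0 < wt (selected (const 1)) ls → Nonempty I)
    subset-of []      []              e = [] , refl , λ ()
    subset-of (g ∷ S) ((b , h) ∷ ls) e with ∷-injectiveˡ e | subset-of S ls (∷-injectiveʳ e)
    subset-of (g ∷ S) ((true  , .g) ∷ ls) e | refl | I , sum≡ , _ =
      inside ∷ I , trans (cong (_⊕_ m n g) sum≡) (⊕-residue g _ _) , λ _ → zero , here
    subset-of (g ∷ S) ((false , .g) ∷ ls) e | refl | I , sum≡ , ne =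
      outside ∷ I , sum≡ , λ pos → let (i , i∈I) = ne pos in suc i , there i∈I

    zeroSumFree⇒¬Sub : ∀ {ℓ} (S : Vec Elt ℓ) → ZeroSumFree m n S → ¬ Sub (ZeroSum m n x-coord y-coord) (toList S)
    zeroSumFree⇒¬Sub S zsf (sub X R s ne (dx , dy))
      -- Chosen terms are labelled `true` and the others `false`; the permutation is then lifted to
      -- the labelled terms.
      with ↭-map-inv proj₂ (↭-trans (↭-reflexive unlabel) s)
      where
      unlabel : map proj₂ (map (true ,_) X ++ map (false ,_) R) ≡ X ++ R
      unlabel = trans (map-++ proj₂ (map (true ,_) X) (map (false ,_) R))
        (cong₂ _++_ (trans (sym (map-∘ X)) (map-id X)) (trans (sym (map-∘ R)) (map-id R)))
    ... | ls , e , s′ with subset-of S ls (sym e)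
    ...   | I , sum≡ , nonempty =
      zsf I (nonempty (subst (0 <_) (trans (sym (wt-1 X)) (total (const 1))) ne))
        (trans sum≡ (cong₂ _,_ (∣⇒mod≡0 _ m (subst (m ∣_) (total x-coord) dx))
                               (∣⇒mod≡0 _ (m * n) (subst (m * n ∣_) (total y-coord) dy))))
      where
      total : ∀ f → wt f X ≡ wt (selected f) ls
      total f = trans (sym (wt-selected f X R)) (wt-↭ (selected f) s′)

  -- Fractions by cross-multiplication

  toℚᵘ-/ : ∀ i d → toℚᵘ (i ℚ./ suc d) ℚᵘ.≃ mkℚᵘ i d
  toℚᵘ-/ i d = ℚ.toℚᵘ-fromℚᵘ (mkℚᵘ i d)

  /-≤ : ∀ a b a′ d .{{_ : NonZero b}} .{{_ : NonZero d}} → a * d ≤ a′ * b → ℤ.+ a ℚ./ b ℚ.≤ ℤ.+ a′ ℚ./ d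
  /-≤ a (suc b) a′ (suc d) h = ℚ.toℚᵘ-cancel-≤
    (ℚᵘ.≤-respˡ-≃ (ℚᵘ.≃-sym (toℚᵘ-/ (ℤ.+ a) b)) (ℚᵘ.≤-respʳ-≃ (ℚᵘ.≃-sym (toℚᵘ-/ (ℤ.+ a′) d))
      (*≤* (subst₂ ℤ._≤_ (ℤ.pos-* a (suc d)) (ℤ.pos-* a′ (suc b)) (ℤ.+≤+ h)))))

  /-< : ∀ a b a′ d .{{_ : NonZero b}} .{{_ : NonZero d}} → a * d < a′ * b → ℤ.+ a ℚ./ b ℚ.< ℤ.+ a′ ℚ./ d
  /-< a (suc b) a′ (suc d) h = ℚ.toℚᵘ-cancel-<
    (ℚᵘ.<-respˡ-≃ (ℚᵘ.≃-sym (toℚᵘ-/ (ℤ.+ a) b)) (ℚᵘ.<-respʳ-≃ (ℚᵘ.≃-sym (toℚᵘ-/ (ℤ.+ a′) d))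
      (*<* (subst₂ ℤ._<_ (ℤ.pos-* a (suc d)) (ℤ.pos-* a′ (suc b)) (ℤ.+<+ h)))))

  /-+ : ∀ a b c d s e .{{_ : NonZero b}} .{{_ : NonZero d}} .{{_ : NonZero e}} →
    (a * d + c * b) * e ≡ s * (b * d) → ℤ.+ a ℚ./ b ℚ.+ ℤ.+ c ℚ./ d ≡ ℤ.+ s ℚ./ e
  /-+ a (suc b) c (suc d) s (suc e) h = ℚ.toℚᵘ-injective
    (ℚᵘ.≃-trans (ℚ.toℚᵘ-homo-+ (ℤ.+ a ℚ./ suc b) (ℤ.+ c ℚ./ suc d))
    (ℚᵘ.≃-trans (ℚᵘ.+-cong (toℚᵘ-/ (ℤ.+ a) b) (toℚᵘ-/ (ℤ.+ c) d))
    (ℚᵘ.≃-trans (*≡* eq) (ℚᵘ.≃-sym (toℚᵘ-/ (ℤ.+ s) e)))))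
    where
    eq : (ℤ.+ a ℤ.* ℤ.+ suc d ℤ.+ ℤ.+ c ℤ.* ℤ.+ suc b) ℤ.* ℤ.+ suc e ≡ ℤ.+ s ℤ.* ℤ.+ (suc b * suc d)
    eq = begin
      (ℤ.+ a ℤ.* ℤ.+ suc d ℤ.+ ℤ.+ c ℤ.* ℤ.+ suc b) ℤ.* ℤ.+ suc e
        ≡⟨ cong₂ (λ u v → (u ℤ.+ v) ℤ.* ℤ.+ suc e) (ℤ.pos-* a (suc d)) (ℤ.pos-* c (suc b)) ⟨
      ℤ.+ (a * suc d + c * suc b) ℤ.* ℤ.+ suc e
        ≡⟨ ℤ.pos-* (a * suc d + c * suc b) (suc e) ⟨
      ℤ.+ ((a * suc d + c * suc b) * suc e)
        ≡⟨ cong ℤ.+_ h ⟩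
      ℤ.+ (s * (suc b * suc d))
        ≡⟨ ℤ.pos-* s (suc b * suc d) ⟩
      ℤ.+ s ℤ.* ℤ.+ (suc b * suc d) ∎
      where open ≡-Reasoning

  -- The bound on the cross number

  module _ (m n : ℕ) .{{_ : NonZero m}} .{{_ : NonZero n}} where

    private
      instance
        mn-nonZero : NonZero (m * n)
        mn-nonZero = m*n≢0 m n

    -- Each 1 / ord(g) is at most a(g) / (mn), and these bounds share a denominator, so they add up
    -- to a single fraction.
    crossNumber-≤ : ∀ (a : G m n → ℕ) {ℓ} (S : Vec (G m n) ℓ) →
      (∀ {g} → g ∈ toList S → m * n ≤ ord m n g * a g) →
      crossNumber m n S ℚ.≤ ℤ.+ wt a (toList S) ℚ./ (m * n)
    crossNumber-≤ a []      h = /-≤ 0 1 0 (m * n) z≤n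
    crossNumber-≤ a (g ∷ S) h = subst (crossNumber m n (g ∷ S) ℚ.≤_)
      (/-+ (a g) (m * n) (wt a (toList S)) (m * n) (a g + wt a (toList S)) (m * n)
        (ring (a g) (wt a (toList S)) (m * n)))
      (ℚ.+-mono-≤
        (/-≤ 1 (ord m n g) (a g) (m * n)
          (subst₂ _≤_ (sym (*-identityˡ (m * n))) (*-comm (ord m n g) (a g)) (h (here refl))))
        (crossNumber-≤ a S (h ∘ there)))
      where
      ring : ∀ a b d → (a * d + b * d) * d ≡ (a + b) * (d * d)
      ring = solve-∀

    numerator : ℕ
    numerator = (m ∸ 1) * n + (m * n ∸ 1)

    numerator≡ : ℤ.+ (m ∸ 1) ℚ./ m ℚ.+ ℤ.+ (m * n ∸ 1) ℚ./ (m * n) ≡ ℤ.+ numerator ℚ./ (m * n)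
    numerator≡ = /-+ (m ∸ 1) m (m * n ∸ 1) (m * n) numerator (m * n) (ring (m ∸ 1) m (m * n ∸ 1) n)
      where
      ring : ∀ a m c n → (a * (m * n) + c * m) * (m * n) ≡ (a * n + c) * (m * (m * n))
      ring = solve-∀

    numerator<2 : ℤ.+ numerator ℚ./ (m * n) ℚ.< ℤ.+ 2 ℚ./ 1
    numerator<2 = /-< numerator (m * n) 2 1 (bound m n)
      where
      ring : ∀ m n → suc ((m * suc n + (n + m * suc n)) * 1) + suc n ≡ 2 * (suc m * suc n)
      ring = solve-∀
      bound : ∀ m n .{{_ : NonZero m}} .{{_ : NonZero n}} → ((m ∸ 1) * n + (m * n ∸ 1)) * 1 < 2 * (m * n)
      -- In the original variables the difference of the two sides is n + 1.
      bound (suc m) (suc n) = ≤-trans (m≤m+n _ (suc n)) (≤-reflexive (ring m n))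

    crossNumber-≤-numerator : ∀ {ℓ} (S : Vec (G m n) ℓ) → ZeroSumFree m n S → m + m * n ∸ 2 ≤ ℓ →
      crossNumber m n S ℚ.≤ ℤ.+ numerator ℚ./ (m * n)
    crossNumber-≤-numerator S zsf long = ℚ.≤-trans (crossNumber-≤ a S mn≤ord*a)
      (/-≤ (wt a (toList S)) (m * n) numerator (m * n)
        (*-monoˡ-≤ (m * n) (total-annihilators m n x y (toList S) zsf′ long′)))
      where
      x = x-coord m n
      y = y-coord m n
      zsf′ = zeroSumFree⇒¬Sub m n S zsf
      long′ : m + m * n ≤ 2 + length (toList S)
      long′ = ≤-trans (m≤n+m∸n (m + m * n) 2)
        (+-monoʳ-≤ 2 (≤-trans long (≤-reflexive (sym (length-toList S)))))
      a : G m n → ℕ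
      a g = annihilators n (y g) n
      1≤a : ∀ g → 1 ≤ a g
      1≤a g = ≤-trans (n≢0⇒n>0 (≢-nonZero⁻¹ n ∘ gcd[m,n]≡0⇒n≡0 (y g))) (gcd≤annihilators n (y g))
      mn≤ord*a : ∀ {g} → g ∈ toList S → m * n ≤ ord m n g * a g
      mn≤ord*a {g} g∈S with ord-spec m n g
      ... | inj₁ (dx , dy) = order-bound m n x y (toList S) zsf′ long′ g∈S (ord m n g) (s≤s z≤n) dx dy
      -- Here `ord` is already at least mn, so a factor of at least 1 suffices.
      ... | inj₂ h = ≤-trans (≤-reflexive (sym (*-identityʳ (m * n)))) (*-mono-≤ h (1≤a g))

open import Data.Nat using (ℕ; _+_; _*_; _∸_; _≤_; NonZero)
open import Data.Vec using (Vec)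
open import Data.Integer using (+_)
open import Data.Rational using (_/_; _<_) renaming (_+_ to _+ℚ_; _≤_ to _≤ℚ_)
open import Data.Rational.Properties using (≤-<-trans)
open import Data.Product using (_×_; _,_)
open import Relation.Binary.PropositionalEquality using (subst; sym)

theorem2p4 : (m n : ℕ) .{{_ : NonZero m}} .{{_ : NonZero n}} →
    (ℓ : ℕ) (S : Vec (G m n) ℓ) → ZeroSumFree m n S → m + m * n ∸ 2 ≤ ℓ →
    (crossNumber m n S ≤ℚ ((+ (m ∸ 1)) / m +ℚ _/_ (+ (m * n ∸ 1)) (m * n) {{mn≢0 m n}}))
    × (crossNumber m n S < (+ 2) / 1)
theorem2p4 m n ℓ S zsf long =
  subst (crossNumber m n S ≤ℚ_) (sym (numerator≡ m n)) bound , ≤-<-trans bound (numerator<2 m n)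
  where
  bound = crossNumber-≤-numerator m n S zsf long
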